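{- Let $G$ be a graph and $G'$ an induced minor of $G$. Then $\mathsf{tree}\text{ - }\alpha(G')\le\mathsf{tree}\text{ - }\alpha(G)$.
   Context: All graphs are finite, simple, and undirected. An edge contraction is the operation of deleting a pair of adjacent vertices and replacing them with a new vertex whose neighborhood is the union of the neighborhoods of the two original vertices (among the remaining vertices). A graph $G'$ is an induced minor of $G$ if $G'$ can be obtained from $G$ by a sequence of vertex deletions and edge contractions. A tree decomposition of a graph $G$ is a pair $\mathcal{T}=(T,\{X_t\}_{t\in V(T)})$ where $T$ is a tree and each node $t$ is assigned a bag $X_t\subseteq V(G)$ such that every vertex of $G$ is in at least one bag, every edge of $G$ has both endpoints in some common bag, and for every $u\in V(G)$ the subgraph of $T$ induced by $\{t: u\in X_t\}$ is connected. The independence number of $\mathcal{T}$ is $\alpha(\mathcal{T})=\max_{t\in V(T)}\alpha(G[X_t])$, where $\alpha(H)$ is the maximum size of an independent set in $H$. The tree-independence number $\mathsf{tree}\text{ - }\alpha(G)$ is the minimum of $\alpha(\mathcal{T})$ over all tree decompositions $\mathcal{T}$ of $G$. -}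

module Defs where

open import Data.Empty using (⊥; ⊥-elim)
open import Data.Fin using (Fin; zero; suc; inject₁; fromℕ; punchIn; punchOut)
open import Data.Fin.Properties using (all?)
open import Data.Fin.Subset using (Subset; inside; outside; _∈_; ∣_∣; ⊤)
open import Data.Fin.Subset.Properties using (_∈?_; ∈⊤; ∣⊥∣≡0; ∉⊥)
import Data.Fin.Subset as Sub
open import Data.List using (List; []; _∷_; _++_; map; filter; allFin)
open import Data.List.Extrema.Nat using (max; argmax-sel; xs≤max)
open import Data.List.Membership.Propositional using () renaming (_∈_ to _∈ˡ_)
open import Data.List.Membership.Propositional.Properties using (∈-map⁺; ∈-map⁻; ∈-++⁺ˡ; ∈-++⁺ʳ; ∈-filter⁺; ∈-filter⁻)
open import Data.List.Relation.Unary.All using (lookup)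
open import Data.List.Relation.Unary.Any using (here)
open import Data.Nat using (ℕ; zero; suc; _+_; _≤_; _<_; s≤s; z≤n)
open import Data.Nat.Induction using (<-rec)
open import Data.Nat.Properties using (≤-antisym; ≮⇒≥)
open import Data.Product using (∃-syntax; _×_; _,_)
open import Data.Sum using (_⊎_; inj₁; inj₂)
open import Data.Vec using ([]; _∷_)
open import Function using (id)
open import Function.Bundles using (_↔_; _⇔_; Inverse)
open import Function.Definitions using (Injective)
open import Level using (0ℓ) renaming (suc to lsuc)
open import Relation.Binary using (Rel; Decidable; Symmetric; Irreflexive)
open import Relation.Binary.Construct.Closure.ReflexiveTransitive using (Star; ε)
open import Relation.Binary.PropositionalEquality using (_≡_; _≢_; refl; sym; trans)
open import Relation.Nullary using (¬_; Dec; yes; no)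
open import Relation.Nullary.Decidable using (¬?; _→-dec_; _⊎-dec_)
open import Relation.Unary using (Pred)

private
  variable
    m n : ℕ

record Graph (n : ℕ) : Set (lsuc 0ℓ) where
  field
    Adj    : Rel (Fin n) 0ℓ
    Adj?   : Decidable Adj
    symm   : Symmetric Adj
    irrefl : Irreflexive _≡_ Adj

open Graph public

record _≅_ (H : Graph m) (G : Graph n) : Set where
  field
    vertices : Fin m ↔ Fin n
    edges    : ∀ x y → Adj H x y ⇔ Adj G (Inverse.to vertices x) (Inverse.to vertices y)

pullback : (Fin m → Fin n) → Graph n → Graph m
pullback f G = record
  { Adj    = λ x y → Adj G (f x) (f y)
  ; Adj?   = λ x y → Adj? G (f x) (f y)
  ; symm   = symm G
  ; irrefl = λ { refl → irrefl G refl }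
  }

-- The increasing enumeration of the elements of X.
elements : (X : Subset n) → Fin ∣ X ∣ → Fin n
elements (outside ∷ X) i       = suc (elements X i)
elements (inside  ∷ X) zero    = zero
elements (inside  ∷ X) (suc i) = suc (elements X i)

_[_] : Graph n → (X : Subset n) → Graph ∣ X ∣
G [ X ] = pullback (elements X) G

delete : Graph (suc n) → Fin (suc n) → Graph n
delete G v = pullback (punchIn v) G

-- Enumerates the vertices other than u and v, as `punchIn v` does for those
-- other than v.
others : {u v : Fin (suc (suc n))} → u ≢ v → Fin n → Fin (suc (suc n))
others {u = u} u≢v i = punchIn u (punchIn (punchOut u≢v) i)

-- Vertex `zero` is the new vertex replacing u and v; vertex `suc i` is the
-- i-th of the remaining vertices.
contract : (G : Graph (suc (suc n))) {u v : Fin (suc (suc n))} → Adj G u v → Graph (suc n)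
contract {n = n} G {u} {v} e = record
  { Adj = A ; Adj? = A? ; symm = λ {x} {y} → A-sym x y ; irrefl = λ { {x} refl → A-irrefl x } }
  where
  ρ : Fin n → Fin (suc (suc n))
  ρ = others {u = u} {v = v} (λ u≡v → irrefl G u≡v e)

  A : Rel (Fin (suc n)) 0ℓ
  A zero    zero    = ⊥
  A zero    (suc j) = Adj G u (ρ j) ⊎ Adj G v (ρ j)
  A (suc i) zero    = Adj G u (ρ i) ⊎ Adj G v (ρ i)
  A (suc i) (suc j) = Adj G (ρ i) (ρ j)

  A? : Decidable A
  A? zero    zero    = no λ ()
  A? zero    (suc j) = Adj? G u (ρ j) ⊎-dec Adj? G v (ρ j)
  A? (suc i) zero    = Adj? G u (ρ i) ⊎-dec Adj? G v (ρ i)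
  A? (suc i) (suc j) = Adj? G (ρ i) (ρ j)

  A-sym : ∀ x y → A x y → A y x
  A-sym zero    (suc j) a = a
  A-sym (suc i) zero    a = a
  A-sym (suc i) (suc j) a = symm G a

  A-irrefl : ∀ x → ¬ A x x
  A-irrefl (suc i) a = irrefl G refl a

-- H ⊴ G : H is, up to isomorphism, the result of a finite sequence of vertex
-- deletions and edge contractions starting from G.
data _⊴_ : Graph m → Graph n → Set (lsuc 0ℓ) where
  done           : {H : Graph m} {G : Graph n} → H ≅ G → H ⊴ G
  by-deletion    : {H : Graph m} {G : Graph (suc n)} (v : Fin (suc n)) →
                   H ⊴ delete G v → H ⊴ G
  by-contraction : {H : Graph m} {G : Graph (suc (suc n))} {u v : Fin (suc (suc n))}
                   (e : Adj G u v) → H ⊴ contract G e → H ⊴ G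

Independent : Graph n → Pred (Subset n) 0ℓ
Independent G S = ∀ x → x ∈ S → ∀ y → y ∈ S → ¬ Adj G x y

independent? : (G : Graph n) (S : Subset n) → Dec (Independent G S)
independent? G S =
  all? λ x → (x ∈? S) →-dec all? λ y → (y ∈? S) →-dec ¬? (Adj? G x y)

subsets : ∀ n → List (Subset n)
subsets zero    = [] ∷ []
subsets (suc n) = map (outside ∷_) (subsets n) ++ map (inside ∷_) (subsets n)

-- The default value 0 of `max` is harmless: the empty set is independent.
α : Graph n → ℕ
α {n} G = max 0 (map ∣_∣ (filter (independent? G) (subsets n)))

∈-subsets : (S : Subset n) → S ∈ˡ subsets n
∈-subsets []                  = here refl
∈-subsets (outside ∷ S)       = ∈-++⁺ˡ (∈-map⁺ (outside ∷_) (∈-subsets S))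
∈-subsets {suc n} (inside ∷ S) =
  ∈-++⁺ʳ (map (outside ∷_) (subsets n)) (∈-map⁺ (inside ∷_) (∈-subsets S))

α-upper : (G : Graph n) (S : Subset n) → Independent G S → ∣ S ∣ ≤ α G
α-upper {n} G S ind = lookup (xs≤max 0 (map ∣_∣ (filter (independent? G) (subsets n))))
  (∈-map⁺ ∣_∣ (∈-filter⁺ (independent? G) (∈-subsets S) ind))

α-attained : (G : Graph n) → ∃[ S ] (Independent G S × ∣ S ∣ ≡ α G)
α-attained {n} G with argmax-sel id 0 (map ∣_∣ (filter (independent? G) (subsets n)))
... | inj₁ α≡0 = Sub.⊥ , (λ x x∈⊥ → ⊥-elim (∉⊥ x∈⊥)) , trans (∣⊥∣≡0 n) (sym α≡0)
... | inj₂ α∈  with ∈-map⁻ ∣_∣ α∈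
...   | S , S∈ , α≡∣S∣ with ∈-filter⁻ (independent? G) {xs = subsets n} S∈
...     | _ , ind = S , ind , sym α≡∣S∣

-- The subgraph of G induced by the vertices satisfying P is connected
-- (nonemptiness is not included).
ConnectedOn : (G : Graph n) → Pred (Fin n) 0ℓ → Set
ConnectedOn G P = ∀ x y → P x → P y → Star (λ a b → P a × P b × Adj G a b) x y

Connected : Graph n → Set
Connected G = ∀ x y → Star (Adj G) x y

-- A cycle c₀ c₁ … c_{ℓ+2} of length ℓ + 3.
record Cycle (G : Graph n) : Set where
  field
    {ℓ}      : ℕ
    c        : Fin (3 + ℓ) → Fin n
    distinct : Injective _≡_ _≡_ c
    step     : ∀ (i : Fin (2 + ℓ)) → Adj G (c (inject₁ i)) (c (suc i))
    close    : Adj G (c (fromℕ (2 + ℓ))) (c zero)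

record IsTree (T : Graph n) : Set where
  field
    nonempty  : 0 < n
    connected : Connected T
    acyclic   : ¬ Cycle T

record TreeDecomposition (G : Graph n) : Set (lsuc 0ℓ) where
  field
    {nodes}      : ℕ
    T            : Graph nodes
    isTree       : IsTree T
    bag          : Fin nodes → Subset n
    vertex-cover : ∀ u → ∃[ t ] u ∈ bag t
    edge-cover   : ∀ u v → Adj G u v → ∃[ t ] (u ∈ bag t × v ∈ bag t)
    subtree      : ∀ u → ConnectedOn T (λ t → u ∈ bag t)

-- The default value 0 of `max` is harmless: a tree has a node.
α-decomposition : {G : Graph n} → TreeDecomposition G → ℕ
α-decomposition {G = G} 𝒯 = max 0 (map (λ t → α (G [ bag t ])) (allFin nodes))
  where open TreeDecomposition 𝒯

-- IsTree-α G k : k is the minimum of the independence numbers of the tree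
-- decompositions of G, that is, tree-α(G) = k.  The minimum ranges over an
-- infinite collection, so it is given as a relation; `IsTree-α-unique` and
-- `IsTree-α-exists` show that it determines exactly one number (existence in
-- the double-negated form, as an instance of the classical least number
-- principle).
IsTree-α : Graph n → ℕ → Set (lsuc 0ℓ)
IsTree-α G k = (∃[ 𝒯 ] α-decomposition {G = G} 𝒯 ≡ k)
             × (∀ (𝒯 : TreeDecomposition G) → k ≤ α-decomposition 𝒯)

IsTree-α-unique : (G : Graph n) {k l : ℕ} → IsTree-α G k → IsTree-α G l → k ≡ l
IsTree-α-unique G ((𝒯 , refl) , k≤) ((𝒰 , refl) , l≤) = ≤-antisym (k≤ 𝒰) (l≤ 𝒯)

trivialDecomposition : (G : Graph n) → TreeDecomposition G
trivialDecomposition G = record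
  { T = K₁
  ; isTree = record
    { nonempty  = s≤s z≤n
    ; connected = λ { zero zero → ε }
    ; acyclic   = λ C → Cycle.close C
    }
  ; bag          = λ _ → ⊤
  ; vertex-cover = λ _ → zero , ∈⊤
  ; edge-cover   = λ _ _ _ → zero , ∈⊤ , ∈⊤
  ; subtree      = λ { _ zero zero _ _ → ε }
  }
  where
  K₁ : Graph 1
  K₁ = record { Adj = λ _ _ → ⊥ ; Adj? = λ _ _ → no id ; symm = id ; irrefl = λ _ → id }

IsTree-α-exists : (G : Graph n) → ¬ ¬ (∃[ k ] IsTree-α G k)
IsTree-α-exists G none = <-rec Unattained descend _ (trivialDecomposition G) refl
  where
  Unattained : ℕ → Set (lsuc 0ℓ)
  Unattained k = (𝒯 : TreeDecomposition G) → ¬ (α-decomposition 𝒯 ≡ k)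

  descend : ∀ k → (∀ {l} → l < k → Unattained l) → Unattained k
  descend k below 𝒯 α≡k =
    none (k , (𝒯 , α≡k) , λ 𝒰 → ≮⇒≥ λ α<k → below α<k 𝒰 refl)

{-# OPTIONS --safe #-}

-- An induced minor H of G is modelled by disjoint connected branch sets in G,
-- one per vertex of H, with an edge between two of them exactly when the
-- vertices are adjacent.  Replacing each bag of a tree decomposition of G by
-- the set of vertices of H whose branch set meets it gives a tree
-- decomposition of H on the same tree.  Choosing for each vertex of a new bag a
-- vertex of its branch set in the old bag maps independent sets injectively to
-- independent sets, so no bag gains in independence number.
module Submission where

open import Data.Fin using (Fin; zero; suc; punchIn; punchOut)
open import Data.Fin.Properties using (_≟_; any?; injective⇒≤; suc-injective; punchIn-injective; punchInᵢ≢i; punchIn-punchOut)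
open import Data.Fin.Subset using (Subset; inside; outside; _∈_; ∣_∣)
open import Data.Fin.Subset.Properties using (_∈?_)
open import Data.List using (allFin)
open import Data.List.Extrema.Nat using (max[xs]≤max[ys]⁺)
open import Data.List.Membership.Propositional using (lose)
open import Data.List.Membership.Propositional.Properties using (∈-map⁺; ∈-allFin)
open import Data.List.Relation.Unary.All using (universal)
open import Data.List.Relation.Unary.All.Properties using () renaming (map⁺ to All-map⁺)
open import Data.Nat using (ℕ; _≤_; z≤n)
open import Data.Nat.Properties using (≤-trans)
open import Data.Product using (∃-syntax; _×_; _,_; proj₁; proj₂)
open import Data.Sum using (_⊎_; inj₁; inj₂)
open import Data.Vec using (_∷_; here; there; tabulate)
open import Data.Vec.Properties using (lookup∘tabulate; lookup⇒[]=; []=⇒lookup)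
open import Function using (_∘_)
open import Function.Bundles using (_⇔_; Inverse; Equivalence; mk⇔)
open import Function.Definitions using (Injective)
open import Level using (0ℓ) renaming (suc to lsuc)
open import Relation.Binary using (REL; Decidable)
open import Relation.Binary.Construct.Closure.ReflexiveTransitive using (Star; ε; _◅_; _◅◅_) renaming (map to Star-map)
open import Relation.Binary.PropositionalEquality using (_≡_; _≢_; refl; sym; trans; cong; subst; subst₂)
open import Relation.Nullary using (¬_; yes; no; does; contradiction)
open import Relation.Nullary.Decidable using (_×-dec_; _⊎-dec_; dec-true)
import Relation.Unary as Unary
open import Relation.Unary using (Pred)
open import Defs

private
  variable
    m n : ℕ

-- Subsets cut out by decidable predicates, and positions in their enumeration.

separate : {P : Pred (Fin n) 0ℓ} → Unary.Decidable P → Subset n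
separate P? = tabulate (does ∘ P?)

∈-separate⁺ : {P : Pred (Fin n) 0ℓ} (P? : Unary.Decidable P) {x : Fin n} → P x → x ∈ separate P?
∈-separate⁺ P? {x} px =
  lookup⇒[]= x _ (trans (lookup∘tabulate (does ∘ P?) x) (dec-true (P? x) px))

∈-separate⁻ : {P : Pred (Fin n) 0ℓ} (P? : Unary.Decidable P) {x : Fin n} → x ∈ separate P? → P x
∈-separate⁻ P? {x} x∈ with P? x | trans (sym (lookup∘tabulate (does ∘ P?) x)) ([]=⇒lookup x∈)
... | yes px | _ = px
... | no _   | ()

elements-∈ : (X : Subset n) (i : Fin ∣ X ∣) → elements X i ∈ X
elements-∈ (outside ∷ X) i       = there (elements-∈ X i)
elements-∈ (inside  ∷ X) zero    = here
elements-∈ (inside  ∷ X) (suc i) = there (elements-∈ X i)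

elements-injective : (X : Subset n) → Injective _≡_ _≡_ (elements X)
elements-injective (outside ∷ X) eq = elements-injective X (suc-injective eq)
elements-injective (inside ∷ X) {zero}  {zero}  eq = refl
elements-injective (inside ∷ X) {suc i} {suc j} eq =
  cong suc (elements-injective X (suc-injective eq))

index : {X : Subset n} {x : Fin n} → x ∈ X → Fin ∣ X ∣
index {X = inside  ∷ X} here       = zero
index {X = inside  ∷ X} (there x∈) = suc (index x∈)
index {X = outside ∷ X} (there x∈) = index x∈

elements-index : {X : Subset n} {x : Fin n} (x∈ : x ∈ X) → elements X (index x∈) ≡ x
elements-index {X = inside  ∷ X} here       = refl
elements-index {X = inside  ∷ X} (there x∈) = cong suc (elements-index x∈)
elements-index {X = outside ∷ X} (there x∈) = cong suc (elements-index x∈)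

index-injective : {X : Subset n} {x y : Fin n} (x∈ : x ∈ X) (y∈ : y ∈ X) →
                  index x∈ ≡ index y∈ → x ≡ y
index-injective {X = X} x∈ y∈ eq =
  trans (sym (elements-index x∈)) (trans (cong (elements X) eq) (elements-index y∈))

-- Bounding independence numbers along injections.

-- The image of `g` is an independent set, and the positions of the values `g i` in its enumeration
-- embed `Fin m` into `Fin ∣ image ∣`.
independent-family⇒≤α : (G : Graph n) (g : Fin m → Fin n) → Injective _≡_ _≡_ g →
                        (∀ i j → ¬ Adj G (g i) (g j)) → m ≤ α G
independent-family⇒≤α G g g-injective ind =
  ≤-trans (injective⇒≤ position-injective) (α-upper G image image-independent)
  where
  inImage? : Unary.Decidable (λ w → ∃[ i ] g i ≡ w)
  inImage? w = any? λ i → g i ≟ w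

  image : Subset _
  image = separate inImage?

  g∈image : ∀ i → g i ∈ image
  g∈image i = ∈-separate⁺ inImage? (i , refl)

  position-injective : Injective _≡_ _≡_ (λ i → index (g∈image i))
  position-injective eq = g-injective (index-injective (g∈image _) (g∈image _) eq)

  image-independent : Independent G image
  image-independent x x∈ y y∈
    with ∈-separate⁻ inImage? x∈ | ∈-separate⁻ inImage? y∈
  ... | i , refl | j , refl = ind i j

-- `f` carries a maximum independent set of `H` to an independent family of the same size: an edge
-- between images would come from an edge of `H`.
α-mono : (H : Graph m) (G : Graph n) (f : Fin m → Fin n) → Injective _≡_ _≡_ f →
         (∀ x y → Adj G (f x) (f y) → Adj H x y) → α H ≤ α G
α-mono H G f f-injective reflects with α-attained H
... | S , ind , ∣S∣≡αH = subst (_≤ α G) ∣S∣≡αH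
  (independent-family⇒≤α G (f ∘ elements S) (elements-injective S ∘ f-injective)
    λ i j → ind _ (elements-∈ S i) _ (elements-∈ S j) ∘ reflects _ _)

-- Minor models and the transfer of tree decompositions along them.

-- Branch sets need not cover `G`, which leaves room for deleted vertices. `reflects` is what makes
-- the minor induced; its case `x ≡ y` admits edges inside a branch set. Decidability of `Branch`
-- lets the new bags be formed as `Subset`s.
record MinorModel (H : Graph m) (G : Graph n) : Set (lsuc 0ℓ) where
  field
    Branch    : REL (Fin m) (Fin n) 0ℓ
    Branch?   : Decidable Branch
    inhabited : ∀ x → ∃[ w ] Branch x w
    connected : ∀ x → ConnectedOn G (Branch x)
    disjoint  : ∀ x y {w} → Branch x w → Branch y w → x ≡ y
    preserves : ∀ x y → Adj H x y → ∃[ w ] ∃[ z ] (Branch x w × Branch y z × Adj G w z)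
    reflects  : ∀ x y {w z} → Branch x w → Branch y z → Adj G w z → x ≡ y ⊎ Adj H x y

module _ {H : Graph m} {G : Graph n} (ℳ : MinorModel H G) (𝒯 : TreeDecomposition G) where
  open MinorModel ℳ
  open TreeDecomposition 𝒯

  Meets : REL (Fin nodes) (Fin m) 0ℓ
  Meets t x = ∃[ w ] (w ∈ bag t × Branch x w)

  meets? : Decidable Meets
  meets? t x = any? λ w → (w ∈? bag t) ×-dec Branch? x w

  minorBag : Fin nodes → Subset m
  minorBag t = separate (meets? t)

  ∈-minorBag : ∀ {t x w} → w ∈ bag t → Branch x w → x ∈ minorBag t
  ∈-minorBag {t} w∈ xw = ∈-separate⁺ (meets? t) (_ , w∈ , xw)

  -- The subtrees of consecutive vertices on a walk in the branch set of x share
  -- a node, so walking along the branch set links them all.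
  link : ∀ x {w z s t} → Star (λ c d → Branch x c × Branch x d × Adj G c d) w z →
         Branch x w → w ∈ bag s → z ∈ bag t →
         Star (λ c d → x ∈ minorBag c × x ∈ minorBag d × Adj T c d) s t
  link x {w} ε xw w∈s w∈t = Star-map
    (λ (w∈c , w∈d , e) → ∈-minorBag w∈c xw , ∈-minorBag w∈d xw , e)
    (subtree w _ _ w∈s w∈t)
  link x ((_ , xw′ , e) ◅ walk) xw w∈s z∈t with edge-cover _ _ e
  ... | r , w∈r , w′∈r = link x ε xw w∈s w∈r ◅◅ link x walk xw′ w′∈r z∈t

  minorDecomposition : TreeDecomposition H
  minorDecomposition = record
    { T            = T
    ; isTree       = isTree
    ; bag          = minorBag
    ; vertex-cover = λ x → let w , xw = inhabited x ; t , w∈t = vertex-cover w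
                           in t , ∈-minorBag w∈t xw
    -- An edge of `G` joins the two branch sets, and a bag containing both its ends meets both sets.
    ; edge-cover   = λ x y e → let w , z , xw , yz , e′ = preserves x y e
                                   t , w∈t , z∈t = edge-cover w z e′
                               in t , ∈-minorBag w∈t xw , ∈-minorBag z∈t yz
    ; subtree      = λ x s t x∈s x∈t →
        let w , w∈s , xw = ∈-separate⁻ (meets? s) x∈s
            z , z∈t , xz = ∈-separate⁻ (meets? t) x∈t
        in link x (connected x w z xw xz) xw w∈s z∈t
    }

  α-minorBag : ∀ t → α (H [ minorBag t ]) ≤ α (G [ bag t ])
  α-minorBag t = α-mono (H [ minorBag t ]) (G [ bag t ]) (λ i → index (rep∈ i)) f-injective f-reflects
    where
    meets : ∀ i → Meets t (elements (minorBag t) i)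
    meets i = ∈-separate⁻ (meets? t) (elements-∈ (minorBag t) i)

    rep : Fin ∣ minorBag t ∣ → Fin n
    rep i = proj₁ (meets i)

    rep∈ : ∀ i → rep i ∈ bag t
    rep∈ i = proj₁ (proj₂ (meets i))

    branch-rep : ∀ i → Branch (elements (minorBag t) i) (rep i)
    branch-rep i = proj₂ (proj₂ (meets i))

    f-injective : Injective _≡_ _≡_ (λ i → index (rep∈ i))
    -- A shared representative lies in the branch sets of both vertices, so disjointness identifies
    -- them.
    f-injective {i} {j} eq = elements-injective (minorBag t)
      (disjoint _ _ (branch-rep i)
        (subst (Branch _) (sym (index-injective (rep∈ i) (rep∈ j) eq)) (branch-rep j)))

    f-reflects : ∀ i j → Adj (G [ bag t ]) (index (rep∈ i)) (index (rep∈ j)) →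
                 Adj (H [ minorBag t ]) i j
    f-reflects i j e
      with e′ ← subst₂ (Adj G) (elements-index (rep∈ i)) (elements-index (rep∈ j)) e
      with reflects _ _ (branch-rep i) (branch-rep j) e′
    ... | inj₂ adj = adj
    -- Equal vertices have the same representative, so `e′` would be a loop in `G`.
    ... | inj₁ eq  =
      contradiction e′ (irrefl G (cong rep (elements-injective (minorBag t) eq)))

  α-minorDecomposition : α-decomposition minorDecomposition ≤ α-decomposition 𝒯
  -- `inj₁ z≤n` compares the two default values 0. Both decompositions have the same nodes, so each
  -- entry is bounded by the entry at the same `t`.
  α-minorDecomposition = max[xs]≤max[ys]⁺ 0 _ (inj₁ z≤n)
    (All-map⁺ (universal
      (λ t → inj₂ (lose (∈-map⁺ (λ t → α (G [ bag t ])) (∈-allFin t)) (α-minorBag t)))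
      (allFin nodes)))

-- Models for isomorphisms, deletions and contractions.

-- Singleton branch sets suffice when `H` sits in `G` as an induced subgraph, which covers both
-- isomorphisms and vertex deletions.
embedding-model : (H : Graph m) (G : Graph n) (f : Fin m → Fin n) → Injective _≡_ _≡_ f →
                  (∀ x y → Adj H x y ⇔ Adj G (f x) (f y)) → MinorModel H G
embedding-model H G f f-injective edges = record
  { Branch    = λ x w → w ≡ f x
  ; Branch?   = λ x w → w ≟ f x
  ; inhabited = λ x → f x , refl
  ; connected = λ { x _ _ refl refl → ε }
  ; disjoint  = λ x y w≡fx w≡fy → f-injective (trans (sym w≡fx) w≡fy)
  ; preserves = λ x y e → f x , f y , refl , refl , Equivalence.to (edges x y) e
  ; reflects  = λ { x y refl refl e → inj₂ (Equivalence.from (edges x y) e) }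
  }

isomorphism-model : {H : Graph m} {G : Graph n} → H ≅ G → MinorModel H G
isomorphism-model {H = H} {G} H≅G = embedding-model H G (Inverse.to vertices) to-injective edges
  where
  open _≅_ H≅G

  to-injective : Injective _≡_ _≡_ (Inverse.to vertices)
  to-injective eq = trans (sym (Inverse.strictlyInverseʳ vertices _))
    (trans (cong (Inverse.from vertices) eq) (Inverse.strictlyInverseʳ vertices _))

deletion-model : (G : Graph (ℕ.suc n)) (v : Fin (ℕ.suc n)) → MinorModel (delete G v) G
deletion-model G v = embedding-model (delete G v) G (punchIn v) (punchIn-injective v _ _)
  λ _ _ → mk⇔ (λ e → e) (λ e → e)

module _ {u v : Fin (ℕ.suc (ℕ.suc n))} (u≢v : u ≢ v) where

  others-injective : Injective _≡_ _≡_ (others u≢v)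
  others-injective = punchIn-injective _ _ _ ∘ punchIn-injective u _ _

  others≢ˡ : ∀ i → others u≢v i ≢ u
  others≢ˡ i = punchInᵢ≢i u _

  others≢ʳ : ∀ i → others u≢v i ≢ v
  -- `punchIn u` sends `punchOut u≢v` to `v`, and the inner `punchIn` skips exactly that point.
  others≢ʳ i eq = punchInᵢ≢i (punchOut u≢v) i
    (punchIn-injective u _ _ (trans eq (sym (punchIn-punchOut u≢v))))

-- The new vertex gets the branch set consisting of `u` and `v`, connected by `e` itself; every
-- other vertex gets a singleton.
contraction-model : (G : Graph (ℕ.suc (ℕ.suc n))) {u v : Fin (ℕ.suc (ℕ.suc n))} (e : Adj G u v) →
                    MinorModel (contract G e) G
contraction-model {n} G {u} {v} e = record
  { Branch    = B
  ; Branch?   = B?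
  ; inhabited = λ { zero → u , inj₁ refl ; (suc i) → ρ i , refl }
  ; connected = B-connected
  ; disjoint  = B-disjoint
  ; preserves = B-preserves
  ; reflects  = B-reflects
  }
  where
  u≢v : u ≢ v
  -- This is the proof used inside `contract`, so `ρ` below agrees by definition with the
  -- enumeration there.
  u≢v u≡v = irrefl G u≡v e

  ρ : Fin n → Fin (ℕ.suc (ℕ.suc n))
  ρ = others u≢v

  B : REL (Fin (ℕ.suc n)) (Fin (ℕ.suc (ℕ.suc n))) 0ℓ
  B zero    w = w ≡ u ⊎ w ≡ v
  B (suc i) w = w ≡ ρ i

  B? : Decidable B
  B? zero    w = (w ≟ u) ⊎-dec (w ≟ v)
  B? (suc i) w = w ≟ ρ i

  B-connected : ∀ x → ConnectedOn G (B x)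
  B-connected zero    _ _ (inj₁ refl) (inj₁ refl) = ε
  B-connected zero    _ _ (inj₁ refl) (inj₂ refl) = (inj₁ refl , inj₂ refl , e) ◅ ε
  B-connected zero    _ _ (inj₂ refl) (inj₁ refl) = (inj₂ refl , inj₁ refl , symm G e) ◅ ε
  B-connected zero    _ _ (inj₂ refl) (inj₂ refl) = ε
  B-connected (suc i) _ _ refl        refl        = ε

  new-old-disjoint : ∀ i {w} → B zero w → w ≢ ρ i
  new-old-disjoint i (inj₁ w≡u) w≡ρi = others≢ˡ u≢v i (trans (sym w≡ρi) w≡u)
  new-old-disjoint i (inj₂ w≡v) w≡ρi = others≢ʳ u≢v i (trans (sym w≡ρi) w≡v)

  B-disjoint : ∀ x y {w} → B x w → B y w → x ≡ y
  B-disjoint zero    zero    _    _    = refl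
  B-disjoint zero    (suc j) w∈uv w≡ρj = contradiction w≡ρj (new-old-disjoint j w∈uv)
  B-disjoint (suc i) zero    w≡ρi w∈uv = contradiction w≡ρi (new-old-disjoint i w∈uv)
  B-disjoint (suc i) (suc j) w≡ρi w≡ρj =
    cong suc (others-injective u≢v (trans (sym w≡ρi) w≡ρj))

  B-preserves : ∀ x y → Adj (contract G e) x y → ∃[ w ] ∃[ z ] (B x w × B y z × Adj G w z)
  B-preserves zero    (suc j) (inj₁ uj) = u , ρ j , inj₁ refl , refl , uj
  B-preserves zero    (suc j) (inj₂ vj) = v , ρ j , inj₂ refl , refl , vj
  B-preserves (suc i) zero    (inj₁ ui) = ρ i , u , refl , inj₁ refl , symm G ui
  B-preserves (suc i) zero    (inj₂ vi) = ρ i , v , refl , inj₂ refl , symm G vi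
  B-preserves (suc i) (suc j) ij        = ρ i , ρ j , refl , refl , ij

  B-reflects : ∀ x y {w z} → B x w → B y z → Adj G w z → x ≡ y ⊎ Adj (contract G e) x y
  -- The edge `e` lies inside this branch set; it is absorbed by the case of equal vertices.
  B-reflects zero    zero    _           _           _  = inj₁ refl
  B-reflects zero    (suc j) (inj₁ refl) refl        uj = inj₂ (inj₁ uj)
  B-reflects zero    (suc j) (inj₂ refl) refl        vj = inj₂ (inj₂ vj)
  B-reflects (suc i) zero    refl        (inj₁ refl) iu = inj₂ (inj₁ (symm G iu))
  B-reflects (suc i) zero    refl        (inj₂ refl) iv = inj₂ (inj₂ (symm G iv))
  B-reflects (suc i) (suc j) refl        refl        ij = inj₂ ij

-- Induction along the sequence of operations.

-- Each constructor exposes the first operation applied to `G`. The decomposition is moved across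
-- that operation, then the recursion continues from the smaller graph, and the inequalities are
-- chained.
⊴-decomposition : {H : Graph m} {G : Graph n} → H ⊴ G → (𝒯 : TreeDecomposition G) →
                  ∃[ 𝒰 ] α-decomposition {G = H} 𝒰 ≤ α-decomposition 𝒯
⊴-decomposition (done H≅G) 𝒯 =
  minorDecomposition (isomorphism-model H≅G) 𝒯 , α-minorDecomposition (isomorphism-model H≅G) 𝒯
⊴-decomposition {G = G} (by-deletion v H⊴) 𝒯
  with 𝒰 , 𝒰≤ ← ⊴-decomposition H⊴ (minorDecomposition (deletion-model G v) 𝒯)
  = 𝒰 , ≤-trans 𝒰≤ (α-minorDecomposition (deletion-model G v) 𝒯)
⊴-decomposition {G = G} (by-contraction e H⊴) 𝒯
  with 𝒰 , 𝒰≤ ← ⊴-decomposition H⊴ (minorDecomposition (contraction-model G e) 𝒯)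
  = 𝒰 , ≤-trans 𝒰≤ (α-minorDecomposition (contraction-model G e) 𝒯)

proposition3p9 : ∀ {m n : ℕ} (G : Graph n) (G′ : Graph m) → G′ ⊴ G →
    ∀ {k k′ : ℕ} → IsTree-α G k → IsTree-α G′ k′ → k′ ≤ k
-- Matching on `refl` replaces `k` by the value of an optimal `𝒯`; its transfer `𝒰` is one of the
-- competitors bounded below by `k′`.
proposition3p9 G G′ G′⊴G ((𝒯 , refl) , _) (_ , k′≤) with 𝒰 , 𝒰≤ ← ⊴-decomposition G′⊴G 𝒯
  = ≤-trans (k′≤ 𝒰) 𝒰≤
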